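{- As formal power series in $q$ (equivalently, for $|q|<1$), $$\sum_{n=0}^{\infty}a^{o}_{od}(n)q^n=\frac{(-q;q^2)_{\infty}}{(q^2;q^2)_{\infty}} \sum_{n=0}^{\infty} \frac{q^{2n^2+n}}{(-q;q^2)_{n+1}}$$ and $$\sum_{n=0}^{\infty}a^{e}_{od}(n)q^n=\frac{(-q;q^2)_{\infty}}{(q^2;q^2)_{\infty}} \left(v_2(q)-\sum_{n=0}^{\infty}\frac{q^{2n^2+n}}{(-q;q^2)_{n}}\right),$$ where $v_2(q):=\sum_{n=0}^{\infty}\frac{q^{2n^2-n}}{(-q;q^2)_n}$.
   Context: Notation: $(a;q)_0:=1$, $(a;q)_n:=\prod_{k=0}^{n-1}(1-aq^k)$, $(a;q)_\infty:=\lim_{n\to\infty}(a;q)_n$. For $n\ge 0$, $\mathcal{P}_{od}(n)$ is the set of all partitions of $n$ in which no odd part is repeated (each odd part appears at most once; even parts may appear with any multiplicity). The empty partition is the unique element of $\mathcal{P}_{od}(0)$. For a partition $\lambda$, $\mathrm{mex}(\lambda)$ is the smallest positive integer that is not a part of $\lambda$. Define $$a^{o}_{od}(n):=\#\{\lambda\in\mathcal{P}_{od}(n): \mathrm{mex}(\lambda)\equiv 1 \pmod 2\},\qquad a^{e}_{od}(n):=\#\{\lambda\in\mathcal{P}_{od}(n): \mathrm{mex}(\lambda)\equiv 0 \pmod 2\}.$$ -}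

module Defs where

open import Data.Nat.Base using (ℕ; zero; suc; _≤_; _<_; _≥_; z≤n; s≤s; z<s; _∸_; _%_; _≤′_; ≤′-refl; ≤′-step)
import Data.Nat.Base as ℕ
import Data.Nat.Properties as ℕ
open import Data.Integer.Base using (ℤ; +_; 0ℤ; 1ℤ)
import Data.Integer.Base as ℤ
import Data.Integer.Properties as ℤ
open import Data.Fin.Base using (Fin; zero; suc; toℕ)
import Data.Fin.Properties as Fin
open import Data.Vec.Functional using (Vector; replicate) renaming (_∷_ to cons)
open import Data.List.Base using (List; []; _∷_; length; filter; applyUpTo; cartesianProductWith)
import Data.List.Properties as List
open import Data.Nat.ListAction using (sum)
open import Data.List.Membership.Propositional using (_∈_; _∉_)
open import Data.List.Membership.Propositional.Properties using (∈-filter⁺; ∈-filter⁻; ∈-cartesianProductWith⁺; ∈-cartesianProductWith⁻; ∈-applyUpTo⁺)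
open import Data.List.Membership.DecPropositional ℕ._≟_ using (_∈?_)
open import Data.List.Relation.Unary.All using (All; []; _∷_; all?)
import Data.List.Relation.Unary.All as All
open import Data.List.Relation.Unary.Any using (here; there)
open import Data.List.Relation.Unary.Linked using (Linked; linked?)
import Data.List.Relation.Unary.AllPairs as AllPairs
open import Data.List.Relation.Unary.Unique.Propositional using (Unique)
import Data.List.Relation.Unary.Unique.Propositional.Properties as Unique
open import Data.Product.Base using (∃; _×_; _,_; proj₁; proj₂)
open import Data.Sum.Base using (inj₁; inj₂)
open import Data.Empty using (⊥-elim)
open import Function.Base using (_∘_)
open import Function.Bundles using (_⇔_; mk⇔)
open import Relation.Nullary using (Dec; yes; no; _×-dec_; _→-dec_)
open import Relation.Binary.PropositionalEquality using (_≡_; _≢_; refl; sym; trans; cong; cong₂; subst; module ≡-Reasoning)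
open import Algebra.Properties.CommutativeMonoid.Sum ℤ.+-0-commutativeMonoid using (sum-cong-≗; sum-replicate-zero; sum-syntax; sum⁺-syntax)
  renaming (sum to sumℤ)

Series : Set
Series = ℕ → ℤ

infix  4 _≈ˢ_
infixl 6 _+ˢ_ _-ˢ_
infixl 7 _*ˢ_ _/ˢ_
infix  8 -ˢ_
infixr 9 _^ˢ_

_≈ˢ_ : Series → Series → Set
f ≈ˢ g = ∀ n → f n ≡ g n

0ˢ 1ˢ q : Series
0ˢ _ = 0ℤ

1ˢ zero    = 1ℤ
1ˢ (suc _) = 0ℤ

q zero    = 0ℤ
q (suc n) = 1ˢ n

_+ˢ_ _-ˢ_ _*ˢ_ : Series → Series → Series
(f +ˢ g) n = f n ℤ.+ g n
(f -ˢ g) n = f n ℤ.- g n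
(f *ˢ g) n = ∑[ i ≤ n ] (f (toℕ i) ℤ.* g (n ∸ toℕ i))

-ˢ_ : Series → Series
(-ˢ f) n = ℤ.- f n

_^ˢ_ : Series → ℕ → Series
f ^ˢ zero  = 1ˢ
f ^ˢ suc n = f *ˢ f ^ˢ n

record ZeroConstant (f : Series) : Set where
  constructor mkZero
  field constant≡0 : f 0 ≡ 0ℤ

open ZeroConstant

-- `inversePrefix f n` lists the coefficients n, n-1, …, 0 of 1/f, computed from
-- (1/f)₀ = 1 and (1/f)ₙ₊₁ = - ∑_{i ≤ n} fᵢ₊₁ (1/f)ₙ₋ᵢ.
inversePrefix : Series → (n : ℕ) → Vector ℤ (suc n)
inversePrefix f zero    = replicate 1 1ℤ
inversePrefix f (suc n) =
  cons (ℤ.- (∑[ i ≤ n ] (f (suc (toℕ i)) ℤ.* inversePrefix f n i))) (inversePrefix f n)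

-- Meaningful only when f has constant term 1; see *ˢ-inverseʳ, and
-- pochhammer-constant and pochhammer∞-constant for the denominators that occur.
inverse : Series → Series
inverse f n = inversePrefix f n zero

_/ˢ_ : Series → Series → Series
f /ˢ g = f *ˢ inverse g

prefix-lookup : ∀ f n (i : Fin (suc n)) →
                inversePrefix f n i ≡ inversePrefix f (n ∸ toℕ i) zero
prefix-lookup f n       zero    = refl
prefix-lookup f (suc n) (suc i) = prefix-lookup f n i

sumℤ-zero : ∀ n (t : Vector ℤ n) → (∀ i → t i ≡ 0ℤ) → sumℤ t ≡ 0ℤ
sumℤ-zero n t t≡0 = trans (sum-cong-≗ t≡0) (sum-replicate-zero n)

*ˢ-inverseʳ : ∀ f → f 0 ≡ 1ℤ → f *ˢ inverse f ≈ˢ 1ˢ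
*ˢ-inverseʳ f f₀≡1 zero    = trans (ℤ.+-identityʳ _) (trans (ℤ.*-identityʳ _) f₀≡1)
*ˢ-inverseʳ f f₀≡1 (suc n) = begin
  f 0 ℤ.* (ℤ.- S) ℤ.+ T  ≡⟨ cong₂ (λ c t → c ℤ.* (ℤ.- S) ℤ.+ t) f₀≡1 T≡S ⟩
  1ℤ ℤ.* (ℤ.- S) ℤ.+ S   ≡⟨ cong (ℤ._+ S) (ℤ.*-identityˡ (ℤ.- S)) ⟩
  ℤ.- S ℤ.+ S            ≡⟨ ℤ.+-inverseˡ S ⟩
  0ℤ                     ∎
  where
  open ≡-Reasoning
  S = ∑[ i ≤ n ] (f (suc (toℕ i)) ℤ.* inversePrefix f n i)
  T = ∑[ i ≤ n ] (f (suc (toℕ i)) ℤ.* inverse f (n ∸ toℕ i))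
  T≡S : T ≡ S
  T≡S = sum-cong-≗ λ i → cong (f (suc (toℕ i)) ℤ.*_) (sym (prefix-lookup f n i))

-- Convergence in the q-adic topology: every coefficient is eventually constant.
Converges : (ℕ → Series) → Set
Converges s = ∀ k → ∃ λ N → ∀ n → N ≤ n → s n k ≡ s N k

lim : (s : ℕ → Series) → Converges s → Series
lim s c k = s (proj₁ (c k)) k

partialSum : (ℕ → Series) → ℕ → Series
partialSum f zero    = 0ˢ
partialSum f (suc n) = partialSum f n +ˢ f n

Summable : (ℕ → Series) → Set
Summable f = Converges (partialSum f)

∑∞ : (f : ℕ → Series) → Summable f → Series
∑∞ f = lim (partialSum f)

stepwise-converges : ∀ s → (∀ n k → k < n → s (suc n) k ≡ s n k) → Converges s
stepwise-converges s step k = suc k , λ n k<n → go (ℕ.≤⇒≤′ k<n)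
  where
  go : ∀ {n} → suc k ≤′ n → s n k ≡ s (suc k) k
  go ≤′-refl                 = refl
  go (≤′-step {n = n} k<′n) = trans (step n k (ℕ.≤′⇒≤ k<′n)) (go k<′n)

-- "f = O(qⁿ)"
VanishesBelow : ℕ → Series → Set
VanishesBelow n f = ∀ k → k < n → f k ≡ 0ℤ

toℕ≤ : ∀ {k} (i : Fin (suc k)) → toℕ i ≤ k
toℕ≤ i = ℕ.≤-pred (Fin.toℕ<n i)

*ˢ-vanishesʳ : ∀ {n} f g → VanishesBelow n g → VanishesBelow n (f *ˢ g)
*ˢ-vanishesʳ f g g≡0 k k<n = sumℤ-zero (suc k) _ λ i →
  trans (cong (f (toℕ i) ℤ.*_) (g≡0 _ (ℕ.≤-<-trans (ℕ.m∸n≤m k (toℕ i)) k<n)))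
        (ℤ.*-zeroʳ (f (toℕ i)))

*ˢ-vanishesˡ : ∀ {n} f g → VanishesBelow n f → VanishesBelow n (f *ˢ g)
*ˢ-vanishesˡ f g f≡0 k k<n = sumℤ-zero (suc k) _ λ i →
  trans (cong (ℤ._* g (k ∸ toℕ i)) (f≡0 _ (ℕ.≤-<-trans (toℕ≤ i) k<n)))
        (ℤ.*-zeroˡ (g (k ∸ toℕ i)))

^ˢ-vanishes : ∀ x → ZeroConstant x → ∀ n → VanishesBelow n (x ^ˢ n)
^ˢ-vanishes x x₀ (suc n) k k<1+n = sumℤ-zero (suc k) _ (term k k<1+n)
  where
  term : ∀ k → k < suc n → (i : Fin (suc k)) → x (toℕ i) ℤ.* (x ^ˢ n) (k ∸ toℕ i) ≡ 0ℤ
  term k       _         zero    =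
    trans (cong (ℤ._* (x ^ˢ n) k) (constant≡0 x₀)) (ℤ.*-zeroˡ ((x ^ˢ n) k))
  term (suc k) (s≤s k<n) (suc i) =
    trans (cong (x (suc (toℕ i)) ℤ.*_)
                (^ˢ-vanishes x x₀ n _ (ℕ.≤-<-trans (ℕ.m∸n≤m k (toℕ i)) k<n)))
          (ℤ.*-zeroʳ (x (suc (toℕ i))))

*ˢ-identityˡ : ∀ g → 1ˢ *ˢ g ≈ˢ g
*ˢ-identityˡ g n = trans
  (cong₂ ℤ._+_ (ℤ.*-identityˡ (g n)) (sumℤ-zero n _ λ i → ℤ.*-zeroˡ (g (n ∸ suc (toℕ i)))))
  (ℤ.+-identityʳ (g n))

summable : ∀ f → (∀ n k → k < n → f n k ≡ 0ℤ) → Summable f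
summable f f≡0 = stepwise-converges (partialSum f) λ n k k<n →
  trans (cong (λ z → partialSum f n k ℤ.+ z) (f≡0 n k k<n)) (ℤ.+-identityʳ _)

-- ⟪ a ⨾ x ⟫[ n ] is the q-Pochhammer symbol (a;x)ₙ, and ⟪ a ⨾ x ⟫∞ is (a;x)_∞.
⟪_⨾_⟫[_] : Series → Series → ℕ → Series
⟪ a ⨾ x ⟫[ zero  ] = 1ˢ
⟪ a ⨾ x ⟫[ suc n ] = (1ˢ -ˢ a *ˢ x ^ˢ n) *ˢ ⟪ a ⨾ x ⟫[ n ]

pochhammer-converges : ∀ a x → ZeroConstant x → Converges ⟪ a ⨾ x ⟫[_]
pochhammer-converges a x x₀ = stepwise-converges ⟪ a ⨾ x ⟫[_] λ n k k<n →
  trans (sum-cong-≗ λ i → cong (ℤ._* ⟪ a ⨾ x ⟫[ n ] (k ∸ toℕ i)) (factor n k k<n i))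
        (*ˢ-identityˡ ⟪ a ⨾ x ⟫[ n ] k)
  where
  factor : ∀ n k → k < n → (i : Fin (suc k)) →
           (1ˢ -ˢ a *ˢ x ^ˢ n) (toℕ i) ≡ 1ˢ (toℕ i)
  factor n k k<n i = trans
    (cong (λ z → 1ˢ (toℕ i) ℤ.- z)
          (*ˢ-vanishesʳ a (x ^ˢ n) (^ˢ-vanishes x x₀ n) (toℕ i) (ℕ.≤-<-trans (toℕ≤ i) k<n)))
    (ℤ.+-identityʳ (1ˢ (toℕ i)))

⟪_⨾_⟫∞ : (a x : Series) → {{ZeroConstant x}} → Series
⟪ a ⨾ x ⟫∞ {{x₀}} = lim ⟪ a ⨾ x ⟫[_] (pochhammer-converges a x x₀)

pochhammer-constant : ∀ a x → ZeroConstant a → ∀ n → ⟪ a ⨾ x ⟫[ n ] 0 ≡ 1ℤ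
pochhammer-constant a x a₀ zero    = refl
pochhammer-constant a x a₀ (suc n) =
  trans (ℤ.+-identityʳ _) (cong₂ ℤ._*_ factor (pochhammer-constant a x a₀ n))
  where
  factor : (1ˢ -ˢ a *ˢ x ^ˢ n) 0 ≡ 1ℤ
  factor = cong (λ c → 1ℤ ℤ.- (c ℤ.+ 0ℤ))
    (trans (cong (ℤ._* (x ^ˢ n) 0) (constant≡0 a₀)) (ℤ.*-zeroˡ ((x ^ˢ n) 0)))

pochhammer∞-constant : ∀ a x → ZeroConstant a → {{x₀ : ZeroConstant x}} → ⟪ a ⨾ x ⟫∞ 0 ≡ 1ℤ
pochhammer∞-constant a x a₀ {{x₀}} =
  pochhammer-constant a x a₀ (proj₁ (pochhammer-converges a x x₀ 0))

instance
  q-zeroConstant : ZeroConstant q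
  q-zeroConstant = mkZero refl

  -q-zeroConstant : ZeroConstant (-ˢ q)
  -q-zeroConstant = mkZero refl

  q²-zeroConstant : ZeroConstant (q ^ˢ 2)
  q²-zeroConstant = mkZero refl

q^/-summable : (e : ℕ → ℕ) (g : ℕ → Series) → (∀ n → n ≤ e n) →
               Summable (λ n → q ^ˢ e n /ˢ g n)
q^/-summable e g n≤e = summable _ λ n k k<n →
  *ˢ-vanishesˡ (q ^ˢ e n) (inverse (g n))
    (^ˢ-vanishes q q-zeroConstant (e n)) k (ℕ.<-≤-trans k<n (n≤e n))

n≤2n²+n : ∀ n → n ≤ 2 ℕ.* n ℕ.^ 2 ℕ.+ n
n≤2n²+n n = ℕ.m≤n+m n (2 ℕ.* n ℕ.^ 2)

n+n≤2n² : ∀ n → n ℕ.+ n ≤ 2 ℕ.* n ℕ.^ 2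
n+n≤2n² n = ℕ.+-mono-≤ (n≤n² n) (ℕ.≤-trans (n≤n² n) (ℕ.m≤m+n (n ℕ.^ 2) 0))
  where
  n≤n² : ∀ n → n ≤ n ℕ.^ 2
  n≤n² zero    = z≤n
  n≤n² (suc n) = ℕ.m≤m*n (suc n) (suc n ℕ.^ 1)

-- In particular the truncated subtraction in 2n² ∸ n is genuine.
n≤2n²∸n : ∀ n → n ≤ 2 ℕ.* n ℕ.^ 2 ∸ n
n≤2n²∸n n = subst (_≤ 2 ℕ.* n ℕ.^ 2 ∸ n) (ℕ.m+n∸n≡m n n) (ℕ.∸-monoˡ-≤ n (n+n≤2n² n))

v₂ : Series
v₂ = ∑∞ (λ n → q ^ˢ (2 ℕ.* n ℕ.^ 2 ∸ n) /ˢ ⟪ -ˢ q ⨾ q ^ˢ 2 ⟫[ n ])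
        (q^/-summable _ ⟪ -ˢ q ⨾ q ^ˢ 2 ⟫[_] n≤2n²∸n)

record IsPartition (n : ℕ) (λs : List ℕ) : Set where
  constructor mkPartition
  field
    decreasing : Linked _≥_ λs
    positive   : All (0 <_) λs
    sum≡n      : sum λs ≡ n

multiplicity : ℕ → List ℕ → ℕ
multiplicity k λs = length (filter (k ℕ.≟_) λs)

NoOddPartRepeated : List ℕ → Set
NoOddPartRepeated λs = All (λ k → k % 2 ≡ 1 → multiplicity k λs ≤ 1) λs

IsPod : ℕ → List ℕ → Set
IsPod n λs = IsPartition n λs × NoOddPartRepeated λs

isPartition? : ∀ n λs → Dec (IsPartition n λs)
isPartition? n λs with linked? ℕ._≥?_ λs | all? (0 ℕ.<?_) λs | sum λs ℕ.≟ n
... | yes d | yes p | yes s = yes (mkPartition d p s)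
... | no ¬d | _     | _     = no (¬d ∘ IsPartition.decreasing)
... | yes _ | no ¬p | _     = no (¬p ∘ IsPartition.positive)
... | yes _ | yes _ | no ¬s = no (¬s ∘ IsPartition.sum≡n)

isPod? : ∀ n λs → Dec (IsPod n λs)
isPod? n λs = isPartition? n λs ×-dec
  all? (λ k → (k % 2 ℕ.≟ 1) →-dec (multiplicity k λs ℕ.≤? 1)) λs

-- Every list of length at most l with entries in {1,…,m}, exactly once.
boundedLists : (m l : ℕ) → List (List ℕ)
boundedLists m zero    = [] ∷ []
boundedLists m (suc l) = [] ∷ cartesianProductWith _∷_ (applyUpTo suc m) (boundedLists m l)

Pod : ℕ → List (List ℕ)
Pod n = filter (isPod? n) (boundedLists n n)

boundedLists-complete : ∀ {m} l λs → All (0 <_) λs → sum λs ≤ m → sum λs ≤ l →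
                        λs ∈ boundedLists m l
boundedLists-complete zero    []           _       _   _   = here refl
boundedLists-complete (suc l) []           _       _   _   = here refl
boundedLists-complete _       (zero ∷ λs)  (() ∷ _) _  _
boundedLists-complete zero    (suc k ∷ λs) _       _   ()
boundedLists-complete (suc l) (suc k ∷ λs) (_ ∷ p) s≤m (s≤s s≤l) =
  there (∈-cartesianProductWith⁺ _∷_
    (∈-applyUpTo⁺ suc (ℕ.≤-trans (s≤s (ℕ.m≤m+n k (sum λs))) s≤m))
    (boundedLists-complete l λs p
      (ℕ.≤-trans (ℕ.m≤n+m (sum λs) (suc k)) s≤m)
      (ℕ.≤-trans (ℕ.m≤n+m (sum λs) k) s≤l)))

boundedLists-unique : ∀ m l → Unique (boundedLists m l)
boundedLists-unique m zero    = [] AllPairs.∷ AllPairs.[]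
boundedLists-unique m (suc l) =
  All.tabulate (λ v∈ → []≢ (∈-cartesianProductWith⁻ _∷_ (applyUpTo suc m) (boundedLists m l) v∈))
  AllPairs.∷
  Unique.cartesianProductWith⁺ _∷_ List.∷-injective
    (Unique.applyUpTo⁺₁ suc m (λ i<j _ eq → ℕ.<⇒≢ i<j (ℕ.suc-injective eq)))
    (boundedLists-unique m l)
  where
  []≢ : ∀ {v} {A B : ℕ → List ℕ → Set} → (∃ λ a → ∃ λ b → A a b × B a b × v ≡ a ∷ b) → [] ≢ v
  []≢ (_ , _ , _ , _ , refl) ()

∈-Pod : ∀ n λs → λs ∈ Pod n ⇔ IsPod n λs
∈-Pod n λs = mk⇔
  (λ λs∈ → proj₂ (∈-filter⁻ (isPod? n) {xs = boundedLists n n} λs∈))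
  (λ pod → let open IsPartition (proj₁ pod) in
    ∈-filter⁺ (isPod? n)
      (boundedLists-complete n λs positive (ℕ.≤-reflexive sum≡n) (ℕ.≤-reflexive sum≡n)) pod)

Pod-unique : ∀ n → Unique (Pod n)
Pod-unique n = Unique.filter⁺ (isPod? n) (boundedLists-unique n n)

-- Tests k, k+1, … in turn; the fuel `sum λs` in `mex` suffices because
-- every part is at most the sum of the parts.
mexFrom : (k fuel : ℕ) → List ℕ → ℕ
mexFrom k zero       λs = k
mexFrom k (suc fuel) λs with k ∈? λs
... | yes _ = mexFrom (suc k) fuel λs
... | no  _ = k

mex : List ℕ → ℕ
mex λs = mexFrom 1 (sum λs) λs

record IsMex (λs : List ℕ) (m : ℕ) : Set where
  constructor mkMex
  field
    positive : 0 < m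
    missing  : m ∉ λs
    smallest : ∀ j → 0 < j → j < m → j ∈ λs

part≤sum : ∀ {k λs} → k ∈ λs → k ≤ sum λs
part≤sum {λs = x ∷ λs} (here refl) = ℕ.m≤m+n x (sum λs)
part≤sum {λs = x ∷ λs} (there k∈)  = ℕ.≤-trans (part≤sum k∈) (ℕ.m≤n+m (sum λs) x)

mexFrom-isMex : ∀ k fuel λs → 0 < k → sum λs < k ℕ.+ fuel →
                (∀ j → 0 < j → j < k → j ∈ λs) → IsMex λs (mexFrom k fuel λs)
mexFrom-isMex k zero λs 0<k s<k below =
  mkMex 0<k (λ k∈ → ℕ.<⇒≱ (subst (sum λs <_) (ℕ.+-identityʳ k) s<k) (part≤sum k∈)) below
mexFrom-isMex k (suc fuel) λs 0<k s<k below with k ∈? λs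
... | no  k∉ = mkMex 0<k k∉ below
... | yes k∈ = mexFrom-isMex (suc k) fuel λs z<s
                 (subst (sum λs <_) (ℕ.+-suc k fuel) s<k) below′
  where
  below′ : ∀ j → 0 < j → j < suc k → j ∈ λs
  below′ j 0<j (s≤s j≤k) with ℕ.m≤n⇒m<n∨m≡n j≤k
  ... | inj₁ j<k  = below j 0<j j<k
  ... | inj₂ refl = k∈

mex-isMex : ∀ λs → IsMex λs (mex λs)
mex-isMex λs = mexFrom-isMex 1 (sum λs) λs z<s ℕ.≤-refl
  λ { zero () _ ; (suc j) _ (s≤s ()) }

aᵒ aᵉ : ℕ → ℕ
aᵒ n = length (filter (λ λs → mex λs % 2 ℕ.≟ 1) (Pod n))
aᵉ n = length (filter (λ λs → mex λs % 2 ℕ.≟ 0) (Pod n))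

generatingSeries : (ℕ → ℕ) → Series
generatingSeries a n = + a n

{-# OPTIONS --safe #-}
-- A partition without repeated odd parts whose mex is 2j+1 contains 1,…,2j and omits 2j+1. The
-- odd parts 1,3,…,2j-1 occur exactly once (weight q^(j²)), the even parts 2,4,…,2j at least once
-- (weight q^(j²+j) on top of the unrestricted factor 1/(q²;q²)_∞), and the larger odd parts
-- contribute (-q;q²)_∞/(-q;q²)_(j+1). The product is the j-th summand of the first identity.
-- If the mex is 2j, then omitting 2j multiplies 1/(q²;q²)_∞ by 1 - q^(2j), so the j-th
-- contribution is the difference of the j-th summands of v₂ and of the subtracted sum; for j = 0
-- that difference vanishes, in accordance with mex > 0.
--
-- Only parts up to 2K matter for the coefficients below K, so finite products in which K
-- exceeds the coefficient index suffice.
module Submission where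

open import Defs
open import Data.Nat.Base using (_+_; _*_; _^_)
open import Data.Product.Base using (_×_)

open import Algebra.Bundles using (CommutativeRing)
import Algebra.Construct.Pointwise as Pointwise
open import Algebra.Properties.CommutativeMonoid.Sum using (sum-cong-≗)
open import Data.Bool.Base using (if_then_else_)
open import Data.Empty using (⊥-elim)
open import Data.Fin.Base using (toℕ)
open import Data.Integer.Base as ℤ using (ℤ; +_; 0ℤ; 1ℤ)
import Data.Integer.Properties as ℤ
import Data.Integer.Tactic.RingSolver as ℤ-Solver
open import Data.List.Base using (List; []; _∷_; length; _++_; map; cartesianProduct; filter; replicate)
open import Data.List.Membership.Propositional using (_∈_; _∉_)
import Data.List.Membership.Propositional.Properties as ∈
open import Data.List.Membership.Propositional.Properties.WithK using (unique∧set⇒bag)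
import Data.List.Properties as List
open import Data.List.Relation.Binary.BagAndSetEquality using (∼bag⇒↭)
open import Data.List.Relation.Binary.Permutation.Propositional.Properties using (↭-length)
open import Data.List.Relation.Unary.All as All using (All; []; _∷_)
import Data.List.Relation.Unary.All.Properties as All
import Data.List.Relation.Unary.AllPairs as AllPairs
open import Data.List.Relation.Unary.Any using (here; there)
open import Data.List.Relation.Unary.Linked as Linked using (Linked; []; [-]; _∷_)
import Data.List.Relation.Unary.Linked.Properties as Linked
open import Data.List.Relation.Unary.Unique.Propositional using (Unique)
import Data.List.Relation.Unary.Unique.Propositional.Properties as Unique
open import Data.Nat.Base as ℕ using (ℕ; zero; suc; _∸_; _%_; _<_; _≤_; _≥_; s≤s; z≤n)
open import Data.Nat.Divisibility using (_∣?_; divides)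
import Data.Nat.DivMod as ℕ
open import Data.Nat.ListAction using (sum)
open import Data.Nat.ListAction.Properties using (sum-++)
import Data.Nat.Properties as ℕ
import Data.Nat.Tactic.RingSolver as ℕ-Solver
open import Data.Product.Base using (∃; ∃₂; _,_; proj₁; proj₂)
open import Data.Sum.Base using (_⊎_; inj₁; inj₂; [_,_]′)
open import Data.Unit.Base using (⊤; tt)
open import Function.Base using (_∘_)
open import Function.Bundles using (_⇔_; mk⇔; module Equivalence)
open import Function.Construct.Identity using (⇔-id)
open import Level using (0ℓ)
open import Relation.Binary.Definitions using (tri<; tri≈; tri>)
open import Relation.Binary.PropositionalEquality using (_≡_; _≢_; refl; sym; trans; cong; cong₂; subst)
open import Relation.Binary.PropositionalEquality using (module ≡-Reasoning)
import Relation.Binary.Reasoning.Setoid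
open import Relation.Nullary using (¬_; yes; no; does)
open import Relation.Unary using (Decidable)

open import Data.List.Membership.DecPropositional ℕ._≟_ using (_∈?_)
open Equivalence using (to; from)

-- The ring of formal power series

-- By definition `(f *ˢ g) (suc n)` is `f 0 ℤ.* g (suc n) ℤ.+ (tail f *ˢ g) n`, so the ring laws are
-- proved by induction on the coefficient index with the left factor replaced by its tail.
tail : Series → Series
tail f = f ∘ suc

infixr 8 _•_
_•_ : ℤ → Series → Series
(c • f) n = c ℤ.* f n

-- Coefficient `n` of a product involves only indices up to `n`; this later permits replacing
-- infinite products and sums by truncations.
*ˢ-cong-≤ : ∀ n {f f′ g g′} → (∀ k → k ≤ n → f k ≡ f′ k) → (∀ k → k ≤ n → g k ≡ g′ k) →
            (f *ˢ g) n ≡ (f′ *ˢ g′) n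
*ˢ-cong-≤ n f≡ g≡ = sum-cong-≗ ℤ.+-0-commutativeMonoid {suc n} λ i →
  cong₂ ℤ._*_ (f≡ (toℕ i) (toℕ≤ i)) (g≡ (n ∸ toℕ i) (ℕ.m∸n≤m n (toℕ i)))

*ˢ-cong : ∀ {f f′ g g′} → f ≈ˢ f′ → g ≈ˢ g′ → f *ˢ g ≈ˢ f′ *ˢ g′
*ˢ-cong f≈ g≈ n = *ˢ-cong-≤ n (λ k _ → f≈ k) (λ k _ → g≈ k)

*ˢ-distribʳ : ∀ h f g → (f +ˢ g) *ˢ h ≈ˢ f *ˢ h +ˢ g *ˢ h
*ˢ-distribʳ h f g zero    = lemma (f 0) (g 0) (h 0)
  where
  lemma : ∀ a b c → (a ℤ.+ b) ℤ.* c ℤ.+ 0ℤ ≡ (a ℤ.* c ℤ.+ 0ℤ) ℤ.+ (b ℤ.* c ℤ.+ 0ℤ)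
  lemma = ℤ-Solver.solve-∀
*ˢ-distribʳ h f g (suc n) = trans
  (cong (λ z → (f 0 ℤ.+ g 0) ℤ.* h (suc n) ℤ.+ z) (*ˢ-distribʳ h (tail f) (tail g) n))
  (lemma (f 0) (g 0) (h (suc n)) ((tail f *ˢ h) n) ((tail g *ˢ h) n))
  where
  lemma : ∀ a b c x y → (a ℤ.+ b) ℤ.* c ℤ.+ (x ℤ.+ y) ≡ (a ℤ.* c ℤ.+ x) ℤ.+ (b ℤ.* c ℤ.+ y)
  lemma = ℤ-Solver.solve-∀

•-*ˢ : ∀ c f g → (c • f) *ˢ g ≈ˢ c • (f *ˢ g)
•-*ˢ c f g zero    = lemma c (f 0) (g 0)
  where
  lemma : ∀ c a b → c ℤ.* a ℤ.* b ℤ.+ 0ℤ ≡ c ℤ.* (a ℤ.* b ℤ.+ 0ℤ)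
  lemma = ℤ-Solver.solve-∀
•-*ˢ c f g (suc n) = trans
  (cong (λ z → c ℤ.* f 0 ℤ.* g (suc n) ℤ.+ z) (•-*ˢ c (tail f) g n))
  (lemma c (f 0) (g (suc n)) ((tail f *ˢ g) n))
  where
  lemma : ∀ c a b x → c ℤ.* a ℤ.* b ℤ.+ c ℤ.* x ≡ c ℤ.* (a ℤ.* b ℤ.+ x)
  lemma = ℤ-Solver.solve-∀

*ˢ-assoc : ∀ f g h → (f *ˢ g) *ˢ h ≈ˢ f *ˢ (g *ˢ h)
*ˢ-assoc f g h zero    = lemma (f 0) (g 0) (h 0)
  where
  lemma : ∀ a b c → (a ℤ.* b ℤ.+ 0ℤ) ℤ.* c ℤ.+ 0ℤ ≡ a ℤ.* (b ℤ.* c ℤ.+ 0ℤ) ℤ.+ 0ℤ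
  lemma = ℤ-Solver.solve-∀
-- The tail of `f *ˢ g` is definitionally `f 0 • tail g +ˢ tail f *ˢ g`.
*ˢ-assoc f g h (suc n) = begin
  (f 0 ℤ.* g 0 ℤ.+ 0ℤ) ℤ.* h (suc n) ℤ.+ ((f 0 • tail g +ˢ tail f *ˢ g) *ˢ h) n
    ≡⟨ cong (λ z → (f 0 ℤ.* g 0 ℤ.+ 0ℤ) ℤ.* h (suc n) ℤ.+ z)
            (trans (*ˢ-distribʳ h (f 0 • tail g) (tail f *ˢ g) n)
                   (cong₂ ℤ._+_ (•-*ˢ (f 0) (tail g) h n) (*ˢ-assoc (tail f) g h n))) ⟩
  (f 0 ℤ.* g 0 ℤ.+ 0ℤ) ℤ.* h (suc n) ℤ.+ (f 0 ℤ.* (tail g *ˢ h) n ℤ.+ (tail f *ˢ (g *ˢ h)) n)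
    ≡⟨ lemma (f 0) (g 0) (h (suc n)) ((tail g *ˢ h) n) ((tail f *ˢ (g *ˢ h)) n) ⟩
  f 0 ℤ.* (g 0 ℤ.* h (suc n) ℤ.+ (tail g *ˢ h) n) ℤ.+ (tail f *ˢ (g *ˢ h)) n ∎
  where
  open ≡-Reasoning
  lemma : ∀ a b c x y → (a ℤ.* b ℤ.+ 0ℤ) ℤ.* c ℤ.+ (a ℤ.* x ℤ.+ y) ≡ a ℤ.* (b ℤ.* c ℤ.+ x) ℤ.+ y
  lemma = ℤ-Solver.solve-∀

-- Splits the convolution at the end opposite to its definition; commutativity matches the two
-- splittings.
*ˢ-lastˡ : ∀ f g n → (f *ˢ g) (suc n) ≡ f (suc n) ℤ.* g 0 ℤ.+ (f *ˢ tail g) n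
*ˢ-lastˡ f g zero    = lemma (f 0) (f 1) (g 0) (g 1)
  where
  lemma : ∀ a b c d → a ℤ.* d ℤ.+ (b ℤ.* c ℤ.+ 0ℤ) ≡ b ℤ.* c ℤ.+ (a ℤ.* d ℤ.+ 0ℤ)
  lemma = ℤ-Solver.solve-∀
*ˢ-lastˡ f g (suc n) = trans
  (cong (λ z → f 0 ℤ.* g (suc (suc n)) ℤ.+ z) (*ˢ-lastˡ (tail f) g n))
  (lemma (f 0 ℤ.* g (suc (suc n))) (f (suc (suc n)) ℤ.* g 0) ((tail f *ˢ tail g) n))
  where
  lemma : ∀ a b c → a ℤ.+ (b ℤ.+ c) ≡ b ℤ.+ (a ℤ.+ c)
  lemma = ℤ-Solver.solve-∀

*ˢ-comm : ∀ f g → f *ˢ g ≈ˢ g *ˢ f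
*ˢ-comm f g zero    = cong (ℤ._+ 0ℤ) (ℤ.*-comm (f 0) (g 0))
*ˢ-comm f g (suc n) = trans
  (cong₂ ℤ._+_ (ℤ.*-comm (f 0) (g (suc n))) (*ˢ-comm (tail f) g n))
  (sym (*ˢ-lastˡ g f n))

seriesRing : CommutativeRing 0ℓ 0ℓ
seriesRing = record
  { Carrier = Series ; _≈_ = _≈ˢ_ ; _+_ = _+ˢ_ ; _*_ = _*ˢ_ ; -_ = -ˢ_ ; 0# = 0ˢ ; 1# = 1ˢ
  ; isCommutativeRing = record
    { isRing = record
      { +-isAbelianGroup = Pointwise.isAbelianGroup ℕ ℤ.+-0-isAbelianGroup
      ; *-cong     = *ˢ-cong
      ; *-assoc    = *ˢ-assoc
      ; *-identity = *ˢ-identityˡ , λ f n → trans (*ˢ-comm f 1ˢ n) (*ˢ-identityˡ f n)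
      ; distrib    = (λ h f g n → trans (*ˢ-comm h (f +ˢ g) n) (trans (*ˢ-distribʳ h f g n)
                       (cong₂ ℤ._+_ (*ˢ-comm f h n) (*ˢ-comm g h n))))
                   , *ˢ-distribʳ
      }
    ; *-comm = *ˢ-comm
    }
  }

-- Finite predicates and their sizes

private variable
  X Y : Set
  z w : ℤ
  P : ℕ → Set

-- The size is an integer so that it can be a coefficient of a `Series`.
record HasSize (Q : X → Set) (z : ℤ) : Set where
  constructor mkSize
  field
    elements : List X
    unique   : Unique elements
    members  : ∀ x → x ∈ elements ⇔ Q x
    size     : + length elements ≡ z

open HasSize

-- Duplicate-free lists with the same members are permutations of each other. Counting one predicate
-- in two ways therefore proves an equation.
HasSize-functional : {Q : X → Set} → HasSize Q z → HasSize Q w → z ≡ w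
HasSize-functional s t = trans (sym (size s)) (trans (cong +_ (↭-length
  (∼bag⇒↭ (unique∧set⇒bag (unique s) (unique t)
    λ {x} → mk⇔ (from (members t x) ∘ to (members s x)) (from (members s x) ∘ to (members t x))))))
  (size t))

HasSize-filter : ∀ {Q : X → Set} {P : X → Set} (P? : Decidable P) {xs} → Unique xs →
                 (∀ x → x ∈ xs ⇔ Q x) → HasSize (λ x → Q x × P x) (+ length (filter P? xs))
HasSize-filter P? {xs} u m = mkSize (filter P? xs) (Unique.filter⁺ P? u)
  (λ x → mk⇔ (λ x∈ → let x∈xs , Px = ∈.∈-filter⁻ P? {xs = xs} x∈ in to (m x) x∈xs , Px)
             (λ (Qx , Px) → ∈.∈-filter⁺ P? (from (m x) Qx) Px))
  refl

HasSize-⊥ : {Q : X → Set} → (∀ x → ¬ Q x) → HasSize Q 0ℤ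
HasSize-⊥ ¬Q = mkSize [] AllPairs.[] (λ x → mk⇔ (λ ()) (λ Qx → ⊥-elim (¬Q x Qx))) refl

HasSize-singleton : {Q : X → Set} → ∀ x → Q x → (∀ y → Q y → y ≡ x) → HasSize Q 1ℤ
HasSize-singleton x Qx only = mkSize (x ∷ []) ([] AllPairs.∷ AllPairs.[])
  (λ y → mk⇔ (λ { (here refl) → Qx }) (λ Qy → here (only y Qy))) refl

HasSize-⊎ : {Q R : X → Set} → (∀ x → Q x → ¬ R x) → HasSize Q z → HasSize R w →
            HasSize (λ x → Q x ⊎ R x) (z ℤ.+ w)
HasSize-⊎ disjoint s t = mkSize (elements s ++ elements t)
  (Unique.++⁺ (unique s) (unique t)
    λ {x} (x∈s , x∈t) → disjoint x (to (members s x) x∈s) (to (members t x) x∈t))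
  (λ x → mk⇔
    (λ x∈ → [ inj₁ ∘ to (members s x) , inj₂ ∘ to (members t x) ]′ (∈.∈-++⁻ (elements s) x∈))
    [ ∈.∈-++⁺ˡ ∘ from (members s x) , ∈.∈-++⁺ʳ (elements s) ∘ from (members t x) ]′)
  (trans (cong +_ (List.length-++ (elements s))) (cong₂ ℤ._+_ (size s) (size t)))

length-cartesianProduct : (xs : List X) (ys : List Y) →
                          length (cartesianProduct xs ys) ≡ length xs * length ys
length-cartesianProduct []       ys = refl
length-cartesianProduct (x ∷ xs) ys = trans (List.length-++ (map (x ,_) ys))
  (cong₂ _+_ (List.length-map (x ,_) ys) (length-cartesianProduct xs ys))

HasSize-× : {Q : X → Set} {R : Y → Set} → HasSize Q z → HasSize R w →
            HasSize (λ (x , y) → Q x × R y) (z ℤ.* w)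
HasSize-× s t = mkSize (cartesianProduct (elements s) (elements t))
  (Unique.cartesianProduct⁺ (unique s) (unique t))
  (λ (x , y) → mk⇔
    (λ xy∈ → let x∈ , y∈ = ∈.∈-cartesianProduct⁻ (elements s) (elements t) xy∈ in
             to (members s x) x∈ , to (members t y) y∈)
    (λ (Qx , Ry) → ∈.∈-cartesianProduct⁺ (from (members s x) Qx) (from (members t y) Ry)))
  (trans (cong +_ (length-cartesianProduct (elements s) (elements t)))
    (trans (ℤ.pos-* (length (elements s)) (length (elements t))) (cong₂ ℤ._*_ (size s) (size t))))

-- Injectivity is asked only on the entries, since the maps used below are injective only on the
-- objects counted.
Unique-map : (h : X → Y) → ∀ xs → (∀ {x y} → x ∈ xs → y ∈ xs → h x ≡ h y → x ≡ y) →
             Unique xs → Unique (map h xs)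
Unique-map h []       inj AllPairs.[]         = AllPairs.[]
Unique-map h (x ∷ xs) inj (x∉ AllPairs.∷ u) =
  All.tabulate (λ y∈ hx≡y → let x′ , x′∈ , y≡ = ∈.∈-map⁻ h y∈ in
    All.lookup x∉ x′∈ (inj (here refl) (there x′∈) (trans hx≡y y≡)))
  AllPairs.∷ Unique-map h xs (λ x∈ y∈ → inj (there x∈) (there y∈)) u

HasSize-image : {Q : X → Set} {R : Y → Set} (h : X → Y) →
                (∀ {x y} → Q x → Q y → h x ≡ h y → x ≡ y) →
                (∀ y → (∃ λ x → Q x × h x ≡ y) ⇔ R y) → HasSize Q z → HasSize R z
HasSize-image h inj R⇔ s = mkSize (map h (elements s))
  (Unique-map h (elements s) (λ {x} {y} x∈ y∈ → inj (to (members s x) x∈) (to (members s y) y∈)) (unique s))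
  (λ y → mk⇔
    (λ y∈ → let x , x∈ , y≡ = ∈.∈-map⁻ h y∈ in to (R⇔ y) (x , to (members s x) x∈ , sym y≡))
    (λ Ry → let x , Qx , hx≡y = from (R⇔ y) Ry in
            subst (_∈ _) hx≡y (∈.∈-map⁺ h (from (members s x) Qx))))
  (trans (cong +_ (List.length-map h (elements s))) (size s))

HasSize-resp : {Q R : X → Set} → (∀ x → Q x ⇔ R x) → HasSize Q z → HasSize R z
HasSize-resp Q⇔R = HasSize-image (λ x → x) (λ _ _ eq → eq)
  λ x → mk⇔ (λ { (_ , Qx , refl) → to (Q⇔R x) Qx }) (λ Rx → x , from (Q⇔R x) Rx , refl)

-- Generating series

-- `A n` is the set of objects of weight `n` in a combinatorial class, and `f` is its ordinary
-- generating function.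
Enumerates : Series → (ℕ → X → Set) → Set
Enumerates f A = ∀ n → HasSize (A n) (f n)

Enumerates-cong : ∀ {f g} {A : ℕ → X → Set} → f ≈ˢ g → Enumerates f A → Enumerates g A
Enumerates-cong {A = A} f≈g s n = subst (HasSize (A n)) (f≈g n) (s n)

Enumerates-resp : ∀ {f} {A B : ℕ → X → Set} → (∀ n x → A n x ⇔ B n x) → Enumerates f A → Enumerates f B
Enumerates-resp A⇔B s n = HasSize-resp (A⇔B n) (s n)

-- Uniqueness of the weight keeps the summands of a convolution disjoint.
Graded : (ℕ → X → Set) → Set
Graded A = ∀ {i j x} → A i x → A j x → i ≡ j

Convolution : (ℕ → X → Set) → (ℕ → Y → Set) → ℕ → X × Y → Set
Convolution A B n (x , y) = ∃₂ λ i j → i + j ≡ n × A i x × B j y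

-- Follows the recursion of the product: either the left component has weight 0, or its weight is
-- lowered by one, which replaces `f` by `tail f`.
Enumerates-*ˢ : ∀ f g {A : ℕ → X → Set} {B : ℕ → Y → Set} → Graded A →
                Enumerates f A → Enumerates g B → Enumerates (f *ˢ g) (Convolution A B)
Enumerates-*ˢ f g {A} {B} gr s t zero = subst (HasSize _) (sym (ℤ.+-identityʳ _))
  (HasSize-resp
    (λ _ → mk⇔ (λ (a , b) → 0 , 0 , refl , a , b) (λ { (0 , 0 , refl , a , b) → a , b }))
    (HasSize-× (s 0) (t 0)))
Enumerates-*ˢ f g {A} {B} gr s t (suc n) = HasSize-resp
  (λ _ → mk⇔
    [ (λ (a , b) → 0 , suc n , refl , a , b)
    , (λ (i , j , eq , a , b) → suc i , j , cong suc eq , a , b) ]′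
    (λ { (0 , j , refl , a , b) → inj₁ (a , b)
       ; (suc i , j , eq , a , b) → inj₂ (i , j , ℕ.suc-injective eq , a , b) }))
  (HasSize-⊎
    (λ { _ (a , _) (_ , _ , _ , a′ , _) → ℕ.0≢1+n (gr a a′) })
    (HasSize-× (s 0) (t (suc n)))
    (Enumerates-*ˢ (tail f) g (λ a a′ → ℕ.suc-injective (gr a a′)) (s ∘ suc) t n))

q*-suc : ∀ f n → (q *ˢ f) (suc n) ≡ f n
q*-suc f n = trans (ℤ.+-identityˡ _) (*ˢ-identityˡ f n)

Enumerates-monomial : (x : X) → ∀ k → Enumerates (q ^ˢ k) (λ n y → n ≡ k × y ≡ x)
Enumerates-monomial x zero    zero    = HasSize-singleton x (refl , refl) (λ _ → proj₂)
Enumerates-monomial x zero    (suc n) = HasSize-⊥ λ { _ (() , _) }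
Enumerates-monomial x (suc k) zero    = HasSize-⊥ λ { _ (() , _) }
Enumerates-monomial x (suc k) (suc n) = subst (HasSize _) (sym (q*-suc (q ^ˢ k) n))
  (HasSize-resp (λ _ → mk⇔ (λ (n≡k , y≡x) → cong suc n≡k , y≡x)
                           (λ (n≡k , y≡x) → ℕ.suc-injective n≡k , y≡x))
                (Enumerates-monomial x k n))

-- The factor contributed by a single part size

Block : (ℕ → Set) → ℕ → ℕ → ℕ → Set
Block P k n m = m * k ≡ n × P m

-- A block of copies of `k` is represented by its multiplicity alone. Here and below the condition
-- is taken up to equivalence, so that a mex condition can be inserted for `P`.
block-0 : ∀ k → (∀ m → m ≡ 0 ⇔ P m) → Enumerates 1ˢ (Block P k)
block-0 k P⇔ = Enumerates-resp
  (λ n m → mk⇔ (λ { (refl , refl) → refl , to (P⇔ 0) refl })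
               (λ (eq , Pm) → let m≡0 = from (P⇔ m) Pm in
                 trans (sym eq) (cong (_* k) m≡0) , m≡0))
  (Enumerates-monomial 0 0)

block-1 : ∀ k → (∀ m → m ≡ 1 ⇔ P m) → Enumerates (q ^ˢ k) (Block P k)
block-1 k P⇔ = Enumerates-resp
  (λ n m → mk⇔ (λ { (refl , refl) → ℕ.*-identityˡ k , to (P⇔ 1) refl })
               (λ (eq , Pm) → let m≡1 = from (P⇔ m) Pm in
                 trans (sym eq) (trans (cong (_* k) m≡1) (ℕ.*-identityˡ k)) , m≡1))
  (Enumerates-monomial 1 k)

block-≤1 : ∀ k → (∀ m → m ≤ 1 ⇔ P m) → Enumerates (1ˢ +ˢ q ^ˢ k) (Block P k)
block-≤1 k P⇔ n = HasSize-resp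
  (λ m → mk⇔ [ (λ { (eq , refl) → eq , to (P⇔ 0) z≤n }) , (λ { (eq , refl) → eq , to (P⇔ 1) ℕ.≤-refl }) ]′
             (λ (eq , Pm) → split eq (from (P⇔ m) Pm)))
  (HasSize-⊎ (λ { m (_ , refl) (_ , ()) })
    (block-0 k (λ _ → ⇔-id _) n) (block-1 k (λ _ → ⇔-id _) n))
  where
  split : ∀ {n m} → m * k ≡ n → m ≤ 1 → Block (_≡ 0) k n m ⊎ Block (_≡ 1) k n m
  split {m = 0} eq _ = inj₁ (eq , refl)
  split {m = 1} eq _ = inj₂ (eq , refl)
  split {m = suc (suc _)} _ (s≤s ())

-- For nonzero `k` this is 1/(1 - q^k), given by its coefficients.
geometric : ℕ → Series
geometric k n = if does (k ∣? n) then 1ℤ else 0ℤ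

module _ (k : ℕ) .{{_ : ℕ.NonZero k}} where

  block-any : (∀ m → P m) → Enumerates (geometric k) (Block P k)
  block-any Pm n with k ∣? n
  ... | yes (divides m n≡mk) = HasSize-singleton m (sym n≡mk , Pm m)
          λ m′ (eq , _) → ℕ.*-cancelʳ-≡ m′ m k (trans eq n≡mk)
  ... | no k∤n = HasSize-⊥ λ m (eq , _) → k∤n (divides m (sym eq))

  -- One copy is set aside, represented by `tt` and weighted by `q ^ˢ k`; the number of further
  -- copies is free.
  block-≥1 : (∀ m → 1 ≤ m ⇔ P m) → Enumerates (q ^ˢ k *ˢ geometric k) (Block P k)
  block-≥1 P⇔ n = HasSize-image (λ (_ , m) → suc m)
    (λ { {_ , m} (_ , _ , _ , (_ , refl) , _) (_ , _ , _ , (_ , refl) , _) refl → refl })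
    (λ m → mk⇔
      (λ { ((_ , m) , (_ , _ , refl , (refl , refl) , (refl , _)) , refl) → refl , to (P⇔ (suc m)) (s≤s z≤n) })
      (λ (eq , Pm) → surj m (from (P⇔ m) Pm) eq))
    (Enumerates-*ˢ (q ^ˢ k) (geometric k) (λ { (refl , _) (refl , _) → refl })
      (Enumerates-monomial tt k) (block-any {P = λ _ → ⊤} _) n)
    where
    surj : ∀ m → 1 ≤ m → m * k ≡ n → _
    surj (suc m) _ eq = (tt , m) , (k , m * k , eq , (refl , refl) , (refl , tt)) , refl

  -- Both sides count blocks of unrestricted multiplicity, the right one by separating multiplicity
  -- 0 from positive multiplicity.
  geometric-unfold : geometric k ≈ˢ 1ˢ +ˢ q ^ˢ k *ˢ geometric k
  geometric-unfold n = HasSize-functional (block-any {P = λ _ → ⊤} _ n)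
    (HasSize-resp (λ m → mk⇔ [ (λ (eq , _) → eq , tt) , (λ (eq , _) → eq , tt) ]′ split)
      (HasSize-⊎ (λ { m (_ , refl) (_ , ()) })
        (block-0 k (λ _ → ⇔-id _) n) (block-≥1 (λ _ → ⇔-id _) n)))
    where
    split : ∀ {n m} → Block (λ _ → ⊤) k n m → Block (_≡ 0) k n m ⊎ Block (1 ≤_) k n m
    split {m = zero}  (eq , _) = inj₁ (eq , refl)
    split {m = suc m} (eq , _) = inj₂ (eq , s≤s z≤n)

-- Partitions with restricted multiplicities

record Restricted (P : ℕ → ℕ → Set) (M n : ℕ) (λs : List ℕ) : Set where
  constructor mkRestricted
  field
    partition : IsPartition n λs
    bounded   : All (_≤ M) λs
    allowed   : ∀ k → 0 < k → k ≤ M → P k (multiplicity k λs)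

open Restricted

multiplicity-++ : ∀ k xs ys → multiplicity k (xs ++ ys) ≡ multiplicity k xs + multiplicity k ys
multiplicity-++ k xs ys =
  trans (cong length (List.filter-++ (k ℕ.≟_) xs ys)) (List.length-++ (filter (k ℕ.≟_) xs))

multiplicity-absent : ∀ {k xs} → All (k ≢_) xs → multiplicity k xs ≡ 0
multiplicity-absent {k} k≢ = cong length (List.filter-none (k ℕ.≟_) k≢)

multiplicity-replicate : ∀ k m → multiplicity k (replicate m k) ≡ m
multiplicity-replicate k m =
  trans (cong length (List.filter-all (k ℕ.≟_) (All.replicate⁺ m refl))) (List.length-replicate m)

sum-replicate : ∀ m k → sum (replicate m k) ≡ m * k
sum-replicate zero    k = refl
sum-replicate (suc m) k = cong (k ℕ.+_) (sum-replicate m k)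

≤⇒All≢ : ∀ {M xs} → All (_≤ M) xs → All (suc M ≢_) xs
≤⇒All≢ = All.map λ x≤M eq → ℕ.<⇒≢ (s≤s x≤M) (sym eq)

multiplicity-top : ∀ M m {μ} → All (_≤ M) μ → multiplicity (suc M) (replicate m (suc M) ++ μ) ≡ m
multiplicity-top M m {μ} μ≤M = begin
  multiplicity (suc M) (replicate m (suc M) ++ μ)
    ≡⟨ multiplicity-++ (suc M) (replicate m (suc M)) μ ⟩
  multiplicity (suc M) (replicate m (suc M)) + multiplicity (suc M) μ
    ≡⟨ cong₂ _+_ (multiplicity-replicate (suc M) m) (multiplicity-absent (≤⇒All≢ μ≤M)) ⟩
  m + 0
    ≡⟨ ℕ.+-identityʳ m ⟩
  m ∎
  where open ≡-Reasoning

multiplicity-below : ∀ {k M} m μ → k ≤ M → multiplicity k (replicate m (suc M) ++ μ) ≡ multiplicity k μ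
multiplicity-below {k} {M} m μ k≤M = trans (multiplicity-++ k (replicate m (suc M)) μ)
  (cong (_+ multiplicity k μ) (multiplicity-absent (All.replicate⁺ m (ℕ.<⇒≢ (s≤s k≤M)))))

decreasing-∷ : ∀ {x xs} → All (_≤ x) xs → Linked _≥_ xs → Linked _≥_ (x ∷ xs)
decreasing-∷ []         []  = [-]
decreasing-∷ (y≤x ∷ _) d   = y≤x ∷ d

decreasing-replicate-++ : ∀ {k μ} m → All (_≤ k) μ → Linked _≥_ μ → Linked _≥_ (replicate m k ++ μ)
decreasing-replicate-++ zero    _   d = d
decreasing-replicate-++ (suc m) μ≤k d =
  decreasing-∷ (All.++⁺ (All.replicate⁺ m ℕ.≤-refl) μ≤k) (decreasing-replicate-++ m μ≤k d)

record TopSplit (M : ℕ) (λs : List ℕ) : Set where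
  constructor mkSplit
  field
    count : ℕ
    rest  : List ℕ
    split : replicate count (suc M) ++ rest ≡ λs
    rest≤ : All (_≤ M) rest
    rest↓ : Linked _≥_ rest

-- In a decreasing list the copies of the largest admissible part form an initial run; once the head
-- is at most `M`, so is everything after it.
topSplit : ∀ {M} λs → Linked _≥_ λs → All (_≤ suc M) λs → TopSplit M λs
topSplit []       _ _           = mkSplit 0 [] refl [] []
topSplit (x ∷ xs) d (x≤ ∷ xs≤) with ℕ.m≤n⇒m<n∨m≡n x≤
... | inj₁ (s≤s x≤M) = mkSplit 0 (x ∷ xs) refl
        (Linked.Linked⇒All (λ j≤i k≤j → ℕ.≤-trans k≤j j≤i) x≤M d) d
... | inj₂ refl = let mkSplit m μ eq μ≤ μ↓ = topSplit xs (Linked.tail d) xs≤ in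
        mkSplit (suc m) μ (cong (x ∷_) eq) μ≤ μ↓

module _ {P : ℕ → ℕ → Set} where

  restricted-0 : Enumerates 1ˢ (Restricted P 0)
  restricted-0 = Enumerates-resp
    (λ n λs → mk⇔ (λ { (refl , refl) → mkRestricted (mkPartition [] [] refl) [] λ { (suc _) _ () } })
                  only-[])
    (Enumerates-monomial [] 0)
    where
    only-[] : ∀ {n λs} → Restricted P 0 n λs → n ≡ 0 × λs ≡ []
    only-[] {λs = []}    (mkRestricted (mkPartition _ _ s) _ _) = sym s , refl
    only-[] {λs = _ ∷ _} (mkRestricted (mkPartition _ (0<x ∷ _) _) (x≤0 ∷ _) _) =
      ⊥-elim (ℕ.<⇒≱ 0<x x≤0)

  -- Removing the initial run of copies of `suc M` is a weight-preserving bijection, so the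
  -- generating function acquires one factor per part size.
  restricted-suc : ∀ M f g → Enumerates f (Block (P (suc M)) (suc M)) → Enumerates g (Restricted P M) →
                   Enumerates (f *ˢ g) (Restricted P (suc M))
  restricted-suc M f g s t n = HasSize-image (λ (m , μ) → replicate m (suc M) ++ μ)
    inj
    (λ λs → mk⇔ (λ { ((m , μ) , (_ , _ , refl , (refl , Pm) , r) , refl) → join m μ Pm r }) unjoin)
    (Enumerates-*ˢ f g (λ (e , _) (e′ , _) → trans (sym e) e′) s t n)
    where
    inj : ∀ {x y} → Convolution (Block (P (suc M)) (suc M)) (Restricted P M) n x →
                    Convolution (Block (P (suc M)) (suc M)) (Restricted P M) n y →
          replicate (proj₁ x) (suc M) ++ proj₂ x ≡ replicate (proj₁ y) (suc M) ++ proj₂ y → x ≡ y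
    -- Both counts equal the multiplicity of `suc M` in the common list; the remainders then agree
    -- by cancellation.
    inj {m , μ} {m′ , μ′} (_ , _ , _ , _ , r) (_ , _ , _ , _ , r′) eq
      with refl ← trans (sym (multiplicity-top M m (bounded r)))
                    (trans (cong (multiplicity (suc M)) eq) (multiplicity-top M m′ (bounded r′)))
      = cong (m ,_) (List.++-cancelˡ (replicate m (suc M)) μ μ′ eq)

    join : ∀ {j} m μ → P (suc M) m → Restricted P M j μ →
           Restricted P (suc M) (m * suc M + j) (replicate m (suc M) ++ μ)
    join m μ Pm (mkRestricted (mkPartition d p s) b a) = mkRestricted
      (mkPartition
        (decreasing-replicate-++ m (All.map ℕ.m≤n⇒m≤1+n b) d)
        (All.++⁺ (All.replicate⁺ m (s≤s z≤n)) p)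
        (trans (sum-++ (replicate m (suc M)) μ) (cong₂ _+_ (sum-replicate m (suc M)) s)))
      (All.++⁺ (All.replicate⁺ m ℕ.≤-refl) (All.map ℕ.m≤n⇒m≤1+n b))
      allowed′
      where
      allowed′ : ∀ k → 0 < k → k ≤ suc M → P k (multiplicity k (replicate m (suc M) ++ μ))
      allowed′ k 0<k k≤ with ℕ.m≤n⇒m<n∨m≡n k≤
      ... | inj₁ (s≤s k≤M) = subst (P k) (sym (multiplicity-below m μ k≤M)) (a k 0<k k≤M)
      ... | inj₂ refl      = subst (P k) (sym (multiplicity-top M m b)) Pm

    unjoin : ∀ {λs} → Restricted P (suc M) n λs →
             ∃ λ x → Convolution (Block (P (suc M)) (suc M)) (Restricted P M) n x ×
                     replicate (proj₁ x) (suc M) ++ proj₂ x ≡ λs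
    unjoin {λs} (mkRestricted (mkPartition d p s) b a) with topSplit λs d b
    ... | mkSplit m μ refl μ≤ μ↓ =
      (m , μ) , (m * suc M , sum μ , sum≡ , (refl , Pm) ,
        mkRestricted (mkPartition μ↓ (All.++⁻ʳ (replicate m (suc M)) p) refl) μ≤ allowed′) , refl
      where
      sum≡ : m * suc M + sum μ ≡ n
      sum≡ = trans (sym (trans (sum-++ (replicate m (suc M)) μ)
                               (cong (_+ sum μ) (sum-replicate m (suc M))))) s
      Pm : P (suc M) m
      Pm = subst (P (suc M)) (multiplicity-top M m μ≤) (a (suc M) (s≤s z≤n) ℕ.≤-refl)
      allowed′ : ∀ k → 0 < k → k ≤ M → P k (multiplicity k μ)
      allowed′ k 0<k k≤M =
        subst (P k) (multiplicity-below m μ k≤M) (a k 0<k (ℕ.m≤n⇒m≤1+n k≤M))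

-- Membership, mex and multiplicities

∉⇒multiplicity≡0 : ∀ {k λs} → k ∉ λs → multiplicity k λs ≡ 0
∉⇒multiplicity≡0 k∉ = multiplicity-absent (All.tabulate λ { x∈ refl → k∉ x∈ })

∈⇔multiplicity≥1 : ∀ k λs → k ∈ λs ⇔ 1 ≤ multiplicity k λs
∈⇔multiplicity≥1 k λs = mk⇔
  (λ k∈ → nonempty (∈.∈-filter⁺ (k ℕ.≟_) k∈ refl))
  present
  where
  nonempty : ∀ {x} {xs : List ℕ} → x ∈ xs → 1 ≤ length xs
  nonempty {xs = _ ∷ _} _ = s≤s z≤n
  present : 1 ≤ multiplicity k λs → k ∈ λs
  present 1≤ with k ∈? λs
  ... | yes k∈ = k∈
  ... | no  k∉ = ⊥-elim (ℕ.<⇒≢ 1≤ (sym (∉⇒multiplicity≡0 k∉)))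

IsMex-unique : ∀ {λs m m′} → IsMex λs m → IsMex λs m′ → m ≡ m′
IsMex-unique {m = m} {m′} (mkMex p a b) (mkMex p′ a′ b′) with ℕ.<-cmp m m′
... | tri< m<m′ _ _ = ⊥-elim (a (b′ m p m<m′))
... | tri≈ _ eq _   = eq
... | tri> _ _ m′<m = ⊥-elim (a′ (b m′ p′ m′<m))

-- Having no repeated odd part and mex `m` amounts to a separate condition on the multiplicity `r`
-- of each part size `k`. This makes the generating function a product.
record MexProfile (m k r : ℕ) : Set where
  constructor mkProfile
  field
    odd   : k % 2 ≡ 1 → r ≤ 1
    below : k < m → 1 ≤ r
    at    : k ≡ m → r ≡ 0

PodMex : ℕ → ℕ → List ℕ → Set
PodMex m n λs = IsPod n λs × mex λs ≡ m

-- From `m ≤ M` the profile is imposed at every size up to the mex; from `n ≤ M` the bound on the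
-- parts holds for every partition of `n`.
restricted⇔PodMex : ∀ {m M n} → 0 < m → m ≤ M → n ≤ M → ∀ λs →
                    Restricted (MexProfile m) M n λs ⇔ PodMex m n λs
restricted⇔PodMex {m} {M} {n} 0<m m≤M n≤M λs = mk⇔ forward backward
  where
  forward : Restricted (MexProfile m) M n λs → PodMex m n λs
  forward (mkRestricted part b a) =
    (part , All.tabulate (λ {k} k∈ → MexProfile.odd
      (a k (All.lookup (IsPartition.positive part) k∈) (All.lookup b k∈)))) ,
    IsMex-unique (mex-isMex λs) (mkMex 0<m
      (λ m∈ → ℕ.<⇒≢ (to (∈⇔multiplicity≥1 m λs) m∈) (sym (MexProfile.at (a m 0<m m≤M) refl)))
      (λ k 0<k k<m → from (∈⇔multiplicity≥1 k λs)
        (MexProfile.below (a k 0<k (ℕ.≤-trans (ℕ.<⇒≤ k<m) m≤M)) k<m)))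

  backward : PodMex m n λs → Restricted (MexProfile m) M n λs
  backward ((part , noOdd) , refl) = mkRestricted part
    (All.tabulate λ k∈ → ℕ.≤-trans (part≤sum k∈) (ℕ.≤-trans (ℕ.≤-reflexive (IsPartition.sum≡n part)) n≤M))
    λ k 0<k _ → mkProfile (odd k)
      (λ k<m → to (∈⇔multiplicity≥1 k λs) (IsMex.smallest (mex-isMex λs) k 0<k k<m))
      (λ { refl → ∉⇒multiplicity≡0 (IsMex.missing (mex-isMex λs)) })
    where
    odd : ∀ k → k % 2 ≡ 1 → multiplicity k λs ≤ 1
    -- `NoOddPartRepeated` speaks only of sizes that occur; the others have multiplicity 0.
    odd k k-odd with k ∈? λs
    ... | yes k∈ = All.lookup noOdd k∈ k-odd
    ... | no  k∉ = subst (_≤ 1) (sym (∉⇒multiplicity≡0 k∉)) z≤n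

-- Even numbers are written j * 2, not 2 * j, because suc j * 2 reduces to suc (suc (j * 2)).
odd%2 : ∀ j → suc (j * 2) % 2 ≡ 1
odd%2 j = ℕ.[m+kn]%n≡m%n 1 j 2

even%2 : ∀ j → (j * 2) % 2 ≡ 0
even%2 j = ℕ.m*n%n≡0 j 2

even-not-odd : ∀ j {A : Set} → (j * 2) % 2 ≡ 1 → A
even-not-odd j eq with () ← trans (sym (even%2 j)) eq

module _ {m : ℕ} where

  -- This and the next four lemmas reduce the profile to a condition covered by the block lemmas,
  -- according to the parity of the size and its position relative to `m`.
  odd-below : ∀ j → suc (j * 2) < m → ∀ r → r ≡ 1 ⇔ MexProfile m (suc (j * 2)) r
  odd-below j k<m r = mk⇔
    (λ { refl → mkProfile (λ _ → ℕ.≤-refl) (λ _ → ℕ.≤-refl) (λ eq → ⊥-elim (ℕ.<⇒≢ k<m eq)) })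
    (λ (mkProfile odd below _) → ℕ.≤-antisym (odd (odd%2 j)) (below k<m))

  even-below : ∀ j → j * 2 < m → ∀ r → 1 ≤ r ⇔ MexProfile m (j * 2) r
  even-below j k<m r = mk⇔
    (λ 1≤r → mkProfile (even-not-odd j) (λ _ → 1≤r) (λ eq → ⊥-elim (ℕ.<⇒≢ k<m eq)))
    (λ p → MexProfile.below p k<m)

  absent-at : ∀ r → r ≡ 0 ⇔ MexProfile m m r
  absent-at r = mk⇔
    (λ { refl → mkProfile (λ _ → z≤n) (λ m<m → ⊥-elim (ℕ.<-irrefl refl m<m)) (λ _ → refl) })
    (λ p → MexProfile.at p refl)

  odd-above : ∀ j → m < suc (j * 2) → ∀ r → r ≤ 1 ⇔ MexProfile m (suc (j * 2)) r
  odd-above j m<k r = mk⇔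
    (λ r≤1 → mkProfile (λ _ → r≤1) (λ k<m → ⊥-elim (ℕ.<-asym m<k k<m)) (λ eq → ⊥-elim (ℕ.<⇒≢ m<k (sym eq))))
    (λ p → MexProfile.odd p (odd%2 j))

  even-above : ∀ j → m < j * 2 → ∀ r → MexProfile m (j * 2) r
  even-above j m<k r =
    mkProfile (even-not-odd j) (λ k<m → ⊥-elim (ℕ.<-asym m<k k<m)) (λ eq → ⊥-elim (ℕ.<⇒≢ m<k (sym eq)))

-- Pochhammer products and their reciprocals

open CommutativeRing seriesRing
  using (setoid; *-commutativeMonoid; +-cong; *-cong; *-congˡ; *-congʳ; *-identityˡ; *-identityʳ; distribˡ; zeroʳ)
  renaming (refl to ≈-refl; sym to ≈-sym; trans to ≈-trans; reflexive to ≈-reflexive)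
open import Algebra.Properties.Ring (CommutativeRing.ring seriesRing)
  using (-‿distribˡ-*; -‿involutive; x[y-z]≈xy-xz)
open import Algebra.Properties.Group (CommutativeRing.+-group seriesRing) using (//-rightDividesʳ)
open import Algebra.Solver.CommutativeMonoid *-commutativeMonoid using (solve; _⊜_; _⊕_)
module ≈-Reasoning = Relation.Binary.Reasoning.Setoid setoid

^ˢ-homo : ∀ f m n → f ^ˢ (m + n) ≈ˢ f ^ˢ m *ˢ f ^ˢ n
^ˢ-homo f zero    n = ≈-sym (*-identityˡ (f ^ˢ n))
^ˢ-homo f (suc m) n = ≈-trans (*-congˡ {f} (^ˢ-homo f m n)) (≈-sym (*ˢ-assoc f (f ^ˢ m) (f ^ˢ n)))

q^-cong : ∀ {m n} → m ≡ n → q ^ˢ m ≈ˢ q ^ˢ n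
q^-cong eq = ≈-reflexive (cong (q ^ˢ_) eq)

q²^ : ∀ j → (q ^ˢ 2) ^ˢ j ≈ˢ q ^ˢ (j * 2)
q²^ zero    = ≈-refl
q²^ (suc j) = ≈-trans (*-congˡ {q ^ˢ 2} (q²^ j)) (≈-sym (^ˢ-homo q 2 (j * 2)))

-ˢ-cong : ∀ {f f′ g g′} → f ≈ˢ f′ → g ≈ˢ g′ → f -ˢ g ≈ˢ f′ -ˢ g′
-ˢ-cong f≈ g≈ n = cong₂ ℤ._-_ (f≈ n) (g≈ n)

-- `E` is the reciprocal of `D`, written as the product of geometric series in which unrestricted
-- even parts are counted.
O E D : ℕ → Series
O n = ⟪ -ˢ q ⨾ q ^ˢ 2 ⟫[ n ]
D n = ⟪ q ^ˢ 2 ⨾ q ^ˢ 2 ⟫[ n ]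
E zero    = 1ˢ
E (suc j) = geometric (suc j * 2) *ˢ E j

O-factor : ∀ j → 1ˢ +ˢ q ^ˢ suc (j * 2) ≈ˢ 1ˢ -ˢ (-ˢ q) *ˢ (q ^ˢ 2) ^ˢ j
O-factor j = +-cong (≈-refl {1ˢ}) (begin
  q *ˢ q ^ˢ (j * 2)               ≈⟨ *-congˡ {q} (q²^ j) ⟨
  q *ˢ (q ^ˢ 2) ^ˢ j              ≈⟨ -‿involutive (q *ˢ (q ^ˢ 2) ^ˢ j) ⟨
  -ˢ (-ˢ (q *ˢ (q ^ˢ 2) ^ˢ j))    ≈⟨ (λ n → cong ℤ.-_ (-‿distribˡ-* q ((q ^ˢ 2) ^ˢ j) n)) ⟩
  -ˢ ((-ˢ q) *ˢ (q ^ˢ 2) ^ˢ j)    ∎)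
  where open ≈-Reasoning

-- With G for the geometric series, expanding only the first term of G - G q^k by G = 1 + q^k G
-- makes everything but 1 cancel.
geometric-inverse : ∀ k .{{_ : ℕ.NonZero k}} → geometric k *ˢ (1ˢ -ˢ q ^ˢ k) ≈ˢ 1ˢ
geometric-inverse k = begin
  geometric k *ˢ (1ˢ -ˢ q ^ˢ k)
    ≈⟨ x[y-z]≈xy-xz (geometric k) 1ˢ (q ^ˢ k) ⟩
  geometric k *ˢ 1ˢ -ˢ geometric k *ˢ q ^ˢ k
    ≈⟨ -ˢ-cong (≈-trans (*-identityʳ (geometric k)) (geometric-unfold k)) (*ˢ-comm (geometric k) (q ^ˢ k)) ⟩
  1ˢ +ˢ q ^ˢ k *ˢ geometric k -ˢ q ^ˢ k *ˢ geometric k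
    ≈⟨ //-rightDividesʳ (q ^ˢ k *ˢ geometric k) 1ˢ ⟩
  1ˢ ∎
  where open ≈-Reasoning

E*D≈1 : ∀ j → E j *ˢ D j ≈ˢ 1ˢ
E*D≈1 zero    = *-identityˡ 1ˢ
E*D≈1 (suc j) = begin
  (geometric k *ˢ E j) *ˢ ((1ˢ -ˢ q ^ˢ 2 *ˢ (q ^ˢ 2) ^ˢ j) *ˢ D j)
    ≈⟨ solve 4 (λ a b c d → (a ⊕ b) ⊕ (c ⊕ d) ⊜ (a ⊕ c) ⊕ (b ⊕ d)) ≈-refl
         (geometric k) (E j) (1ˢ -ˢ q ^ˢ 2 *ˢ (q ^ˢ 2) ^ˢ j) (D j) ⟩
  (geometric k *ˢ (1ˢ -ˢ q ^ˢ 2 *ˢ (q ^ˢ 2) ^ˢ j)) *ˢ (E j *ˢ D j)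
    ≈⟨ *-cong (*-congˡ {geometric k} (-ˢ-cong (≈-refl {1ˢ}) (q²^ (suc j)))) (E*D≈1 j) ⟩
  (geometric k *ˢ (1ˢ -ˢ q ^ˢ k)) *ˢ 1ˢ
    ≈⟨ ≈-trans (*-identityʳ _) (geometric-inverse k) ⟩
  1ˢ ∎
  where
  open ≈-Reasoning
  k = suc j * 2

O*O⁻¹≈1 : ∀ j → O j *ˢ inverse (O j) ≈ˢ 1ˢ
O*O⁻¹≈1 j = *ˢ-inverseʳ (O j) (pochhammer-constant (-ˢ q) (q ^ˢ 2) -q-zeroConstant j)

-- Enumeration of the partitions with a given mex

-- All dependence on the mex sits in `X`. Beyond `K * 2`, each step admits one more odd part at most
-- once and one more even part freely, which extends `O` and `E` by one factor each and leaves `X`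
-- alone.
restricted-above-mex : ∀ {m} K X → m ≤ K * 2 →
  Enumerates (O K *ˢ E K *ˢ X) (Restricted (MexProfile m) (K * 2)) →
  ∀ d → Enumerates (O (d + K) *ˢ E (d + K) *ˢ X) (Restricted (MexProfile m) ((d + K) * 2))
restricted-above-mex K X m≤ s zero    = s
restricted-above-mex {m} K X m≤ s (suc d) = Enumerates-cong rearrange
  (restricted-suc (suc (L * 2)) g _ (block-any (suc L * 2) (even-above (suc L) (ℕ.m≤n⇒m≤1+n m<)))
    (restricted-suc (L * 2) o (O L *ˢ E L *ˢ X) (block-≤1 (suc (L * 2)) (odd-above L m<))
      (restricted-above-mex K X m≤ s d)))
  where
  open ≈-Reasoning
  L = d + K
  g = geometric (suc L * 2)
  o = 1ˢ +ˢ q ^ˢ suc (L * 2)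
  m< : m < suc (L * 2)
  m< = s≤s (ℕ.≤-trans m≤ (ℕ.*-monoˡ-≤ 2 (ℕ.m≤n+m K d)))
  rearrange : g *ˢ (o *ˢ (O L *ˢ E L *ˢ X)) ≈ˢ O (suc L) *ˢ E (suc L) *ˢ X
  rearrange = begin
    g *ˢ (o *ˢ (O L *ˢ E L *ˢ X))
      ≈⟨ solve 5 (λ a b c d e → a ⊕ (b ⊕ ((c ⊕ d) ⊕ e)) ⊜ ((b ⊕ c) ⊕ (a ⊕ d)) ⊕ e) ≈-refl
           g o (O L) (E L) X ⟩
    (o *ˢ O L) *ˢ (g *ˢ E L) *ˢ X
      ≈⟨ *-congʳ {X} (*-congʳ {g *ˢ E L} (*-congʳ {O L} (O-factor L))) ⟩
    O (suc L) *ˢ E (suc L) *ˢ X ∎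

-- One copy of each of 1, ..., 2j is forced, of total weight 2j² + j; surplus copies, possible only
-- for even parts, are counted by `E j`.
restricted-below-mex : ∀ {m} j → j * 2 < m →
            Enumerates (q ^ˢ (2 * j ^ 2 + j) *ˢ E j) (Restricted (MexProfile m) (j * 2))
restricted-below-mex zero    _ = Enumerates-cong (≈-sym (*-identityˡ 1ˢ)) restricted-0
restricted-below-mex (suc j) 2j+2<m = Enumerates-cong rearrange
  (restricted-suc k₁ (q ^ˢ k₂ *ˢ g) _ (block-≥1 k₂ (even-below (suc j) 2j+2<m))
    (restricted-suc (j * 2) (q ^ˢ k₁) (q ^ˢ e *ˢ E j) (block-1 k₁ (odd-below j 2j+1<m))
      (restricted-below-mex j (ℕ.<-trans (ℕ.n<1+n (j * 2)) 2j+1<m))))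
  where
  open ≈-Reasoning
  k₁ = suc (j * 2)
  k₂ = suc j * 2
  e  = 2 * j ^ 2 + j
  g  = geometric k₂
  2j+1<m = ℕ.<-trans (ℕ.n<1+n k₁) 2j+2<m
  -- Squares appear here in the form to which `j ^ 2` and `suc j ^ 2` reduce.
  exponent : ∀ j → suc j * 2 + (suc (j * 2) + (2 * (j * (j * 1)) + j)) ≡ 2 * (suc j * (suc j * 1)) + suc j
  exponent = ℕ-Solver.solve-∀
  rearrange : (q ^ˢ k₂ *ˢ g) *ˢ (q ^ˢ k₁ *ˢ (q ^ˢ e *ˢ E j)) ≈ˢ q ^ˢ (2 * suc j ^ 2 + suc j) *ˢ E (suc j)
  rearrange = begin
    (q ^ˢ k₂ *ˢ g) *ˢ (q ^ˢ k₁ *ˢ (q ^ˢ e *ˢ E j))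
      ≈⟨ solve 5 (λ a b c d e → (a ⊕ b) ⊕ (c ⊕ (d ⊕ e)) ⊜ (a ⊕ (c ⊕ d)) ⊕ (b ⊕ e)) ≈-refl
           (q ^ˢ k₂) g (q ^ˢ k₁) (q ^ˢ e) (E j) ⟩
    (q ^ˢ k₂ *ˢ (q ^ˢ k₁ *ˢ q ^ˢ e)) *ˢ E (suc j)
      ≈⟨ *-congʳ {E (suc j)} (≈-trans (*-congˡ {q ^ˢ k₂} (≈-sym (^ˢ-homo q k₁ e)))
           (≈-trans (≈-sym (^ˢ-homo q k₂ (k₁ + e))) (q^-cong (exponent j)))) ⟩
    q ^ˢ (2 * suc j ^ 2 + suc j) *ˢ E (suc j) ∎

-- The mex contributes the factor 1 and the next even part is free. Inserting `O (suc j)` times its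
-- inverse gives the shape from which `restricted-above-mex` starts.
restricted-oddMex : ∀ j → Enumerates (O (suc j) *ˢ E (suc j) *ˢ (q ^ˢ (2 * j ^ 2 + j) /ˢ O (suc j)))
                          (Restricted (MexProfile (suc (j * 2))) (suc j * 2))
restricted-oddMex j = Enumerates-cong rearrange
  (restricted-suc (suc (j * 2)) g _ (block-any (suc j * 2) (even-above (suc j) (ℕ.n<1+n _)))
    (restricted-suc (j * 2) 1ˢ (Q *ˢ E j) (block-0 (suc (j * 2)) absent-at)
      (restricted-below-mex j (ℕ.n<1+n _))))
  where
  open ≈-Reasoning
  g = geometric (suc j * 2)
  Q = q ^ˢ (2 * j ^ 2 + j)
  O⁻¹ = inverse (O (suc j))
  rearrange : g *ˢ (1ˢ *ˢ (Q *ˢ E j)) ≈ˢ O (suc j) *ˢ E (suc j) *ˢ (Q *ˢ O⁻¹)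
  rearrange = begin
    g *ˢ (1ˢ *ˢ (Q *ˢ E j))
      ≈⟨ *-congˡ {g} (*-congʳ {Q *ˢ E j} (O*O⁻¹≈1 (suc j))) ⟨
    g *ˢ ((O (suc j) *ˢ O⁻¹) *ˢ (Q *ˢ E j))
      ≈⟨ solve 5 (λ a b c d e → a ⊕ ((b ⊕ c) ⊕ (d ⊕ e)) ⊜ (b ⊕ (a ⊕ e)) ⊕ (d ⊕ c)) ≈-refl
           g (O (suc j)) O⁻¹ Q (E j) ⟩
    O (suc j) *ˢ E (suc j) *ˢ (Q *ˢ O⁻¹) ∎

restricted-evenMex : ∀ j → Enumerates (O (suc j) *ˢ E (suc j) *ˢ
                             (q ^ˢ (2 * suc j ^ 2 ∸ suc j) /ˢ O (suc j)
                              -ˢ q ^ˢ (2 * suc j ^ 2 + suc j) /ˢ O (suc j)))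
                           (Restricted (MexProfile (suc j * 2)) (suc j * 2))
restricted-evenMex j = Enumerates-cong rearrange
  (restricted-suc k₁ 1ˢ _ (block-0 k₂ absent-at)
    (restricted-suc (j * 2) (q ^ˢ k₁) (q ^ˢ e *ˢ E j) (block-1 k₁ (odd-below j (ℕ.n<1+n k₁)))
      (restricted-below-mex j (ℕ.m≤n⇒m≤1+n (ℕ.n<1+n _)))))
  where
  open ≈-Reasoning
  k₁ = suc (j * 2)
  k₂ = suc j * 2
  e  = 2 * j ^ 2 + j
  g  = geometric k₂
  a  = 2 * suc j ^ 2 ∸ suc j
  b  = 2 * suc j ^ 2 + suc j
  O⁺ = O (suc j)
  O⁻¹ = inverse O⁺
  -- Exhibits `suc j` as a summand, so that the truncated subtraction in `a` cancels it exactly.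
  square : ∀ j → 2 * (suc j * (suc j * 1)) ≡ (suc (j * 2) + (2 * (j * (j * 1)) + j)) + suc j
  square = ℕ-Solver.solve-∀
  k₁+e≡a : k₁ + e ≡ a
  k₁+e≡a = sym (trans (cong (_∸ suc j) (square j)) (ℕ.m+n∸n≡m (k₁ + e) (suc j)))
  shift : ∀ j → (suc (j * 2) + (2 * (j * (j * 1)) + j)) + suc j * 2 ≡ 2 * (suc j * (suc j * 1)) + suc j
  shift = ℕ-Solver.solve-∀
  a+k₂≡b : a + k₂ ≡ b
  a+k₂≡b = trans (cong (_+ k₂) (sym k₁+e≡a)) (shift j)
  rearrange : 1ˢ *ˢ (q ^ˢ k₁ *ˢ (q ^ˢ e *ˢ E j)) ≈ˢ O⁺ *ˢ E (suc j) *ˢ (q ^ˢ a *ˢ O⁻¹ -ˢ q ^ˢ b *ˢ O⁻¹)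
  rearrange = begin
    1ˢ *ˢ (q ^ˢ k₁ *ˢ (q ^ˢ e *ˢ E j))
      ≈⟨ *-cong (≈-sym (O*O⁻¹≈1 (suc j))) (≈-trans (≈-sym (*ˢ-assoc (q ^ˢ k₁) (q ^ˢ e) (E j)))
           (*-congʳ {E j} (≈-trans (≈-sym (^ˢ-homo q k₁ e)) (q^-cong k₁+e≡a)))) ⟩
    (O⁺ *ˢ O⁻¹) *ˢ (q ^ˢ a *ˢ E j)
      ≈⟨ *-identityˡ _ ⟨
    1ˢ *ˢ ((O⁺ *ˢ O⁻¹) *ˢ (q ^ˢ a *ˢ E j))
      -- The unit is written as `g` times its inverse: `g` completes `E j` to `E (suc j)`, and
      -- `1ˢ -ˢ q ^ˢ k₂` produces the difference of the two summands.
      ≈⟨ *-congʳ {(O⁺ *ˢ O⁻¹) *ˢ (q ^ˢ a *ˢ E j)} (geometric-inverse k₂) ⟨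
    (g *ˢ (1ˢ -ˢ q ^ˢ k₂)) *ˢ ((O⁺ *ˢ O⁻¹) *ˢ (q ^ˢ a *ˢ E j))
      ≈⟨ solve 6 (λ g y o i a e → (g ⊕ y) ⊕ ((o ⊕ i) ⊕ (a ⊕ e)) ⊜ (o ⊕ (g ⊕ e)) ⊕ ((a ⊕ i) ⊕ y)) ≈-refl
           g (1ˢ -ˢ q ^ˢ k₂) O⁺ O⁻¹ (q ^ˢ a) (E j) ⟩
    O⁺ *ˢ E (suc j) *ˢ ((q ^ˢ a *ˢ O⁻¹) *ˢ (1ˢ -ˢ q ^ˢ k₂))
      ≈⟨ *-congˡ {O⁺ *ˢ E (suc j)} (≈-trans (x[y-z]≈xy-xz (q ^ˢ a *ˢ O⁻¹) 1ˢ (q ^ˢ k₂))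
           (-ˢ-cong (*-identityʳ (q ^ˢ a *ˢ O⁻¹)) (≈-trans
             (solve 3 (λ x y z → (x ⊕ y) ⊕ z ⊜ (x ⊕ z) ⊕ y) ≈-refl (q ^ˢ a) O⁻¹ (q ^ˢ k₂))
             (*-congʳ {O⁻¹} (≈-trans (≈-sym (^ˢ-homo q a k₂)) (q^-cong a+k₂≡b)))))) ⟩
    O⁺ *ˢ E (suc j) *ˢ (q ^ˢ a *ˢ O⁻¹ -ˢ q ^ˢ b *ˢ O⁻¹) ∎

-- Passage to the infinite products

D∞ F : Series
D∞ = ⟪ q ^ˢ 2 ⨾ q ^ˢ 2 ⟫∞
F = ⟪ -ˢ q ⨾ q ^ˢ 2 ⟫∞ /ˢ D∞

-- Coefficient `k` is stable from index `suc k` on, and `k < K` means `suc k ≤ K`.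
pochhammer∞-coefficient : ∀ a x {{x₀ : ZeroConstant x}} K k → k < K → ⟪ a ⨾ x ⟫∞ k ≡ ⟪ a ⨾ x ⟫[ K ] k
pochhammer∞-coefficient a x {{x₀}} K k k<K = sym (proj₂ (pochhammer-converges a x x₀ k) K k<K)

-- The uniqueness argument for inverses, carried out up to index `k`: there `D∞` may be replaced by
-- `D K`, which `E K` inverts.
E-coefficient : ∀ K k → k < K → E K k ≡ inverse D∞ k
E-coefficient K k k<K = begin
  E K k                           ≡⟨ *-identityʳ (E K) k ⟨
  (E K *ˢ 1ˢ) k                   ≡⟨ *-congˡ {E K} D∞*D∞⁻¹≈1 k ⟨
  (E K *ˢ (D∞ *ˢ inverse D∞)) k   ≡⟨ *ˢ-cong-≤ k {E K} {E K} (λ _ _ → refl) truncate ⟩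
  (E K *ˢ (D K *ˢ inverse D∞)) k  ≡⟨ *ˢ-assoc (E K) (D K) (inverse D∞) k ⟨
  (E K *ˢ D K *ˢ inverse D∞) k    ≡⟨ *-congʳ {inverse D∞} (E*D≈1 K) k ⟩
  (1ˢ *ˢ inverse D∞) k            ≡⟨ *-identityˡ (inverse D∞) k ⟩
  inverse D∞ k                    ∎
  where
  open ≡-Reasoning
  D∞*D∞⁻¹≈1 = *ˢ-inverseʳ D∞ (pochhammer∞-constant (q ^ˢ 2) (q ^ˢ 2) q²-zeroConstant)
  truncate : ∀ l → l ≤ k → (D∞ *ˢ inverse D∞) l ≡ (D K *ˢ inverse D∞) l
  truncate l l≤k = *ˢ-cong-≤ l {D∞} {D K} {inverse D∞} {inverse D∞}
    (λ i i≤l → pochhammer∞-coefficient (q ^ˢ 2) (q ^ˢ 2) K i (ℕ.≤-<-trans (ℕ.≤-trans i≤l l≤k) k<K))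
    (λ _ _ → refl)

F-coefficient : ∀ K X n → n < K → (O K *ˢ E K *ˢ X) n ≡ (F *ˢ X) n
F-coefficient K X n n<K = *ˢ-cong-≤ n {O K *ˢ E K} {F} {X} {X}
  (λ k k≤n → *ˢ-cong-≤ k {O K} {⟪ -ˢ q ⨾ q ^ˢ 2 ⟫∞} {E K} {inverse D∞}
    (λ i i≤k → sym (pochhammer∞-coefficient (-ˢ q) (q ^ˢ 2) K i (ℕ.≤-<-trans (ℕ.≤-trans i≤k k≤n) n<K)))
    (λ i i≤k → E-coefficient K i (ℕ.≤-<-trans (ℕ.≤-trans i≤k k≤n) n<K)))
  (λ _ _ → refl)

PodMex-enumerates : ∀ {m} K X → 0 < m → m ≤ K * 2 →
  Enumerates (O K *ˢ E K *ˢ X) (Restricted (MexProfile m) (K * 2)) → Enumerates (F *ˢ X) (PodMex m)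
PodMex-enumerates {m} K X 0<m m≤ s n = subst (HasSize _) (F-coefficient L X n (s≤s (ℕ.m≤m+n n K)))
  (HasSize-resp (restricted⇔PodMex 0<m
      (ℕ.≤-trans m≤ (ℕ.*-monoˡ-≤ 2 (ℕ.m≤n+m K (suc n))))
      (ℕ.≤-trans (ℕ.≤-trans (ℕ.n≤1+n n) (ℕ.m≤m+n (suc n) K)) (ℕ.m≤m*n L 2)))
    (restricted-above-mex K X m≤ s (suc n) n))
  -- The summand `suc n` puts `L` above the coefficient index and `L * 2` above every part; the
  -- summand `K` keeps the mex in range.
  where L = suc n + K

-- Summation over the mex values of one parity

HasSize-∃< : ∀ {X : Set} (Q : ℕ → X → Set) → Graded Q → ∀ t n → (∀ j → HasSize (Q j) (t j n)) →
             ∀ N → HasSize (λ x → ∃ λ j → j < N × Q j x) (partialSum t N n)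
HasSize-∃< Q gr t n s zero    = HasSize-⊥ λ { _ (_ , () , _) }
HasSize-∃< Q gr t n s (suc N) = HasSize-resp
  (λ x → mk⇔ [ (λ (j , j<N , Qx) → j , ℕ.m≤n⇒m≤1+n j<N , Qx) , (λ Qx → N , ℕ.n<1+n N , Qx) ]′ split)
  -- Here `Graded` concerns the summation index: no object lies in two of the classes.
  (HasSize-⊎ (λ { x (j , j<N , Qx) Qx′ → ℕ.<⇒≢ j<N (gr Qx Qx′) }) (HasSize-∃< Q gr t n s N) (s N))
  where
  split : ∀ {x} → (∃ λ j → j < suc N × Q j x) → (∃ λ j → j < N × Q j x) ⊎ Q N x
  split (j , s≤s j≤N , Qx) with ℕ.m≤n⇒m<n∨m≡n j≤N
  ... | inj₁ j<N  = inj₁ (j , j<N , Qx)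
  ... | inj₂ refl = inj₂ Qx

*ˢ-partialSum : ∀ f t N → partialSum (λ j → f *ˢ t j) N ≈ˢ f *ˢ partialSum t N
*ˢ-partialSum f t zero    = ≈-sym (zeroʳ f)
*ˢ-partialSum f t (suc N) = ≈-trans (+-cong (*ˢ-partialSum f t N) (≈-refl {f *ˢ t N}))
  (≈-sym (distribˡ f (partialSum t N) (t N)))

partialSum-distrib-ˢ : ∀ s t N → partialSum (λ j → s j -ˢ t j) N ≈ˢ partialSum s N -ˢ partialSum t N
partialSum-distrib-ˢ s t zero    n = refl
partialSum-distrib-ˢ s t (suc N) n = trans (cong (ℤ._+ (s N n ℤ.- t N n)) (partialSum-distrib-ˢ s t N n))
  (lemma (partialSum s N n) (partialSum t N n) (s N n) (t N n))
  where
  lemma : ∀ a b c d → (a ℤ.- b) ℤ.+ (c ℤ.- d) ≡ (a ℤ.+ c) ℤ.- (b ℤ.+ d)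
  lemma = ℤ-Solver.solve-∀

∑∞-coefficient : ∀ e g n≤e N k → k < N →
                 partialSum (λ n → q ^ˢ e n /ˢ g n) N k ≡ ∑∞ (λ n → q ^ˢ e n /ˢ g n) (q^/-summable e g n≤e) k
∑∞-coefficient e g n≤e N k k<N = proj₂ (q^/-summable e g n≤e k) N k<N

-- If the mex exceeds 1, its predecessor is a part and hence at most `n`.
mex≤1+n : ∀ {n λs} → IsPod n λs → mex λs ≤ suc n
mex≤1+n {n} {λs} (part , _) with mex λs | mex-isMex λs
... | zero  | _ = z≤n
... | suc m | mkMex _ _ smallest with m
...   | zero   = s≤s z≤n
...   | suc m′ = s≤s (ℕ.≤-trans (part≤sum (smallest (suc m′) (s≤s z≤n) ℕ.≤-refl))
                                (ℕ.≤-reflexive (IsPartition.sum≡n part)))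

-- The witness `j` is half the mex, rounded down; by `mex≤1+n` it lies below `suc (suc n)`, so a
-- finite partial sum accounts for every partition of `n`.
mex≡r+2j⇔ : ∀ {n r} → r % 2 ≡ r → ∀ λs →
            (∃ λ j → j < suc (suc n) × PodMex (r + j * 2) n λs) ⇔ (IsPod n λs × mex λs % 2 ≡ r)
mex≡r+2j⇔ {n} {r} r%2≡r λs = mk⇔
  (λ (j , _ , pod , eq) → pod , trans (cong (_% 2) eq) (trans (ℕ.[m+kn]%n≡m%n r j 2) r%2≡r))
  (λ (pod , eq) → let j = mex λs ℕ./ 2 in
    j , s≤s (ℕ.≤-trans (ℕ.m/n≤m (mex λs) 2) (mex≤1+n pod)) , pod ,
    trans (ℕ.m≡m%n+[m/n]*n (mex λs) 2) (cong (_+ j * 2) eq))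

count-by-residue : ∀ r t → r % 2 ≡ r → (∀ j → Enumerates (F *ˢ t j) (PodMex (r + j * 2))) → ∀ n →
                   + length (filter (λ λs → mex λs % 2 ℕ.≟ r) (Pod n)) ≡ (F *ˢ partialSum t (suc (suc n))) n
count-by-residue r t r%2≡r s n = trans
  (HasSize-functional
    (HasSize-filter (λ λs → mex λs % 2 ℕ.≟ r) (Pod-unique n) (∈-Pod n))
    (HasSize-resp (mex≡r+2j⇔ r%2≡r)
      (HasSize-∃< (λ j → PodMex (r + j * 2) n)
        (λ (_ , e) (_ , e′) → ℕ.*-cancelʳ-≡ _ _ 2 (ℕ.+-cancelˡ-≡ r _ _ (trans (sym e) e′)))
        (λ j → F *ˢ t j) n (λ j → s j n) (suc (suc n)))))
  (*ˢ-partialSum F t (suc (suc n)) n)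

oddTerm evenTerm : ℕ → Series
oddTerm  j = q ^ˢ (2 * j ^ 2 + j) /ˢ O (j + 1)
evenTerm j = q ^ˢ (2 * j ^ 2 ∸ j) /ˢ O j -ˢ q ^ˢ (2 * j ^ 2 + j) /ˢ O j

oddTerm-enumerates : ∀ j → Enumerates (F *ˢ oddTerm j) (PodMex (1 + j * 2))
oddTerm-enumerates j = subst
  (λ i → Enumerates (F *ˢ (q ^ˢ (2 * j ^ 2 + j) /ˢ O i)) (PodMex (1 + j * 2)))
  (sym (ℕ.+-comm j 1))
  (PodMex-enumerates (suc j) (q ^ˢ (2 * j ^ 2 + j) /ˢ O (suc j)) (s≤s z≤n) (ℕ.n≤1+n _) (restricted-oddMex j))

evenTerm-enumerates : ∀ j → Enumerates (F *ˢ evenTerm j) (PodMex (j * 2))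
-- No mex is 0, and for this index both summands are `1ˢ /ˢ 1ˢ`, so the class is empty and the term
-- vanishes.
evenTerm-enumerates zero    = Enumerates-cong
  (≈-trans (≈-sym (zeroʳ F)) (*-congˡ {F} λ n → sym (ℤ.+-inverseʳ ((1ˢ /ˢ 1ˢ) n))))
  (λ n → HasSize-⊥ λ λs (_ , mex≡0) → ℕ.<⇒≢ (IsMex.positive (mex-isMex λs)) (sym mex≡0))
evenTerm-enumerates (suc j) =
  PodMex-enumerates (suc j) (evenTerm (suc j)) (s≤s z≤n) ℕ.≤-refl (restricted-evenMex j)

theorem1p1 : (generatingSeries aᵒ
    ≈ˢ (⟪ -ˢ q ⨾ q ^ˢ 2 ⟫∞ /ˢ ⟪ q ^ˢ 2 ⨾ q ^ˢ 2 ⟫∞)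
    *ˢ ∑∞ (λ n → q ^ˢ (2 * n ^ 2 + n) /ˢ ⟪ -ˢ q ⨾ q ^ˢ 2 ⟫[ n + 1 ])
    (q^/-summable _ (λ n → ⟪ -ˢ q ⨾ q ^ˢ 2 ⟫[ n + 1 ]) n≤2n²+n))
    ×
    (generatingSeries aᵉ
    ≈ˢ (⟪ -ˢ q ⨾ q ^ˢ 2 ⟫∞ /ˢ ⟪ q ^ˢ 2 ⨾ q ^ˢ 2 ⟫∞)
    *ˢ (v₂ -ˢ ∑∞ (λ n → q ^ˢ (2 * n ^ 2 + n) /ˢ ⟪ -ˢ q ⨾ q ^ˢ 2 ⟫[ n ])
    (q^/-summable _ ⟪ -ˢ q ⨾ q ^ˢ 2 ⟫[_] n≤2n²+n)))
theorem1p1 =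
  (λ n → trans (count-by-residue 1 oddTerm refl oddTerm-enumerates n)
    -- The partial sum already has the final coefficients at all `k ≤ n`, the only ones entering
    -- coefficient `n` of the product.
    (*ˢ-cong-≤ n {F} {F} {partialSum oddTerm (suc (suc n))} (λ _ _ → refl) λ k k≤n →
      ∑∞-coefficient (λ j → 2 * j ^ 2 + j) (λ j → O (j + 1)) n≤2n²+n (suc (suc n)) k (k<2+n k≤n))) ,
  (λ n → trans (count-by-residue 0 evenTerm refl evenTerm-enumerates n)
    (*ˢ-cong-≤ n {F} {F} {partialSum evenTerm (suc (suc n))} (λ _ _ → refl) λ k k≤n →
      trans (partialSum-distrib-ˢ (λ j → q ^ˢ (2 * j ^ 2 ∸ j) /ˢ O j) (λ j → q ^ˢ (2 * j ^ 2 + j) /ˢ O j) (suc (suc n)) k)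
        (cong₂ ℤ._-_
          (∑∞-coefficient (λ j → 2 * j ^ 2 ∸ j) O n≤2n²∸n (suc (suc n)) k (k<2+n k≤n))
          (∑∞-coefficient (λ j → 2 * j ^ 2 + j) O n≤2n²+n (suc (suc n)) k (k<2+n k≤n)))))
  where
  k<2+n : ∀ {k n} → k ≤ n → k < suc (suc n)
  k<2+n k≤n = s≤s (ℕ.m≤n⇒m≤1+n k≤n)
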